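{- Let $\mathcal{D}$ be either $(\mathbb{Z},<,=)$ or $(\mathbb{N},<,=)$. Consider the restriction of the CLTL realizability problem over $\mathcal{D}$ to instances in which the system owns exactly one variable $y$, which is a look-ahead variable, and the environment owns exactly one look-ahead variable $x$ together with an arbitrary finite set $W$ of future-blind variables (the size of $W$ is not bounded; it is part of the input). This restricted problem (given the CLTL formula $\phi$ and the variable partition, decide whether the system has a winning strategy in the CLTL game with winning condition $\phi$) is undecidable.
   Context: A constraint system is $\mathcal{D}=(D,R_1,\dots,R_n,\mathcal{I})$ with $D$ a nonempty domain and each predicate symbol $R_i$ of arity $a_i$ interpreted as $\mathcal{I}(R_i)\subseteq D^{a_i}$; in $(\mathbb{Z},<,=)$ and $(\mathbb{N},<,=)$ the symbols $<,=$ have their usual meaning. A finite set of variables $V$ is partitioned into look-ahead variables $V^a$ and future-blind variables $V^b$. A look-ahead term is $X^i y$ with $y\in V^a$, $i\ge 0$. A constraint is $R(t_1,\dots,t_n)$ where either all $t_j$ are future-blind variables or all $t_j$ are look-ahead terms. CLTL formulas: $\phi ::= c \mid \lnot\phi \mid \phi\lor\phi \mid X\phi \mid \phi U\phi$ with $c$ a constraint. A concrete model is a sequence $\sigma=\sigma(0)\sigma(1)\cdots$ of mappings $\sigma(i)\colon V\to D$. Semantics: $\sigma,i\models R(X^{i_1}x_1,\dots,X^{i_n}x_n)$ iff $(\sigma(i+i_1)(x_1),\dots,\sigma(i+i_n)(x_n))\in\mathcal{I}(R)$; for future-blind $x_1,\dots,x_n$, $\sigma,i\models R(x_1,\dots,x_n)$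 iff $(\sigma(i)(x_1),\dots,\sigma(i)(x_n))\in\mathcal{I}(R)$; Boolean connectives, $X$ (next) and $U$ (until) as in LTL; $F$, $G$ are the usual abbreviations. CLTL game: $V$ is partitioned into $\mathit{SV}$ (system) and $\mathit{EV}$ (environment). In each round $i=0,1,\dots$ the environment picks $\mathit{em}_i\colon\mathit{EV}\to D$, then the system (knowing all previous choices and $\mathit{em}_i$) picks $\mathit{sm}_i\colon\mathit{SV}\to D$; the play yields the concrete model $\sigma$ with $\sigma(i)=\mathit{em}_i\oplus\mathit{sm}_i$ (the union of the two mappings). A system strategy is a function from finite sequences of mappings $V\to D$ followed by a mapping $\mathit{EV}\to D$ to mappings $\mathit{SV}\to D$; it is winning if every play consistent with it yields $\sigma$ with $\sigma,0\models\phi$. The realizability problem asks, given $\phi$, whether the system has a winning strategy. -}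

module Defs where

open import Data.Nat using (ℕ; zero; suc; _+_; _*_; ⌊_/2⌋)
open import Data.Integer using (ℤ)
import Data.Integer as ℤ
import Data.Nat as ℕ
open import Data.Fin using (Fin; toℕ)
open import Data.List using (List; []; _∷_; _∷ʳ_)
open import Data.Maybe using (Maybe; just; nothing)
open import Data.Product using (Σ; _×_; _,_; ∃)
open import Data.Empty using (⊥)
open import Relation.Nullary using (¬_)
open import Relation.Binary.PropositionalEquality using (_≡_)

data Dom : Set where
  ZZ NN : Dom

Carrier : Dom → Set
Carrier ZZ = ℤ
Carrier NN = ℕ

data Pred : Set where
  lt eq : Pred

interp : (D : Dom) → Pred → Carrier D → Carrier D → Set
interp ZZ lt a b = a ℤ.< b
interp NN lt a b = a ℕ.< b
interp D  eq a b = a ≡ b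

-- Variables of a restricted instance with |W| = k:
--   look-ahead: x (environment), y (system);
--   future-blind: w i, i : Fin k (environment).

data LAVar : Set where
  x y : LAVar

data Var (k : ℕ) : Set where
  vx vy : Var k
  vw    : Fin k → Var k

laVar : ∀ {k} → LAVar → Var k
laVar x = vx
laVar y = vy

data EVar (k : ℕ) : Set where
  ex : EVar k
  ew : Fin k → EVar k

data SVar : Set where
  sy : SVar

-- Constraints R(t1,t2): either both look-ahead terms X^i u, X^j v,
-- or both future-blind variables.
data Constraint (k : ℕ) : Set where
  laC : Pred → LAVar → ℕ → LAVar → ℕ → Constraint k
  fbC : Pred → Fin k → Fin k → Constraint k

data Formula (k : ℕ) : Set where
  atom  : Constraint k → Formula k
  ¬'_   : Formula k → Formula k
  _∨'_  : Formula k → Formula k → Formula k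
  X'_   : Formula k → Formula k
  _U'_  : Formula k → Formula k → Formula k

Model : Dom → ℕ → Set
Model D k = ℕ → Var k → Carrier D

satC : ∀ {D k} → Model D k → ℕ → Constraint k → Set
satC {D} σ i (laC R u a v b) = interp D R (σ (i + a) (laVar u)) (σ (i + b) (laVar v))
satC {D} σ i (fbC R p q)     = interp D R (σ i (vw p)) (σ i (vw q))

_,_⊨_ : ∀ {D k} → Model D k → ℕ → Formula k → Set
σ , i ⊨ atom c = satC σ i c
σ , i ⊨ (¬' φ) = ¬ (σ , i ⊨ φ)
σ , i ⊨ (φ ∨' ψ) = (σ , i ⊨ φ) Data.Sum.⊎ (σ , i ⊨ ψ)
  where import Data.Sum
σ , i ⊨ (X' φ) = σ , suc i ⊨ φ
σ , i ⊨ (φ U' ψ) =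
  Σ ℕ λ j → (σ , (i + j) ⊨ ψ) × (∀ l → l ℕ.< j → σ , (i + l) ⊨ φ)

Valuation : Dom → ℕ → Set
Valuation D k = Var k → Carrier D

EMove : Dom → ℕ → Set
EMove D k = EVar k → Carrier D

SMove : Dom → Set
SMove D = SVar → Carrier D

_⊕_ : ∀ {D k} → EMove D k → SMove D → Valuation D k
(em ⊕ sm) vx     = em ex
(em ⊕ sm) (vw i) = em (ew i)
(em ⊕ sm) vy     = sm sy

-- system strategy: finite history (chronological) + current env move ↦ system move
Strategy : Dom → ℕ → Set
Strategy D k = List (Valuation D k) → EMove D k → SMove D

history : ∀ {D k} → Strategy D k → (ℕ → EMove D k) → ℕ → List (Valuation D k)
round   : ∀ {D k} → Strategy D k → (ℕ → EMove D k) → ℕ → Valuation D k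
history str em zero    = []
history str em (suc n) = history str em n ∷ʳ round str em n
round str em n = em n ⊕ str (history str em n) (em n)

play : ∀ {D k} → Strategy D k → (ℕ → EMove D k) → Model D k
play = round

Winning : ∀ {D k} → Strategy D k → Formula k → Set
Winning {D} {k} str φ = ∀ (em : ℕ → EMove D k) → play str em , 0 ⊨ φ

Realizable : (D : Dom) (k : ℕ) → Formula k → Set
Realizable D k φ = Σ (Strategy D k) λ str → Winning str φ

data Instr : Set where
  inc  : ℕ → Instr
  decjz : ℕ → ℕ → Instr

Program : Set
Program = List Instr

nth : ∀ {A : Set} → List A → ℕ → Maybe A
nth []       _       = nothing
nth (a ∷ as) zero    = just a
nth (a ∷ as) (suc n) = nth as n

Config : Set
Config = ℕ × (ℕ → ℕ)

update : (ℕ → ℕ) → ℕ → ℕ → (ℕ → ℕ)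
update f r v n with r ℕ.≟ n
... | Relation.Nullary.yes _ = v
  where import Relation.Nullary
... | Relation.Nullary.no _  = f n
  where import Relation.Nullary

execInstr : Instr → Config → Config
execInstr (inc r) (pc , regs) = suc pc , update regs r (suc (regs r))
execInstr (decjz r l) (pc , regs) with regs r
... | zero  = l , regs
... | suc v = suc pc , update regs r v

step : Program → Config → Config
step P (pc , regs) with nth P pc
... | nothing = pc , regs
... | just i  = execInstr i (pc , regs)

run : Program → ℕ → Config → Config
run P zero    c = c
run P (suc t) c = run P t (step P c)

Halted : Program → Config → Set
Halted P (pc , _) = nth P pc ≡ nothing

initConfig : ℕ → Config
initConfig n = 0 , λ { zero → n ; (suc _) → 0 }

Outputs : Program → ℕ → ℕ → Set
Outputs P n m = Σ ℕ λ t → Halted P (run P t (initConfig n))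
                        × Data.Product.proj₂ (run P t (initConfig n)) 0 ≡ m

-- Gödel numbering of restricted instances (Cantor pairing)

pair : ℕ → ℕ → ℕ
pair a b = ⌊ (a + b) * suc (a + b) /2⌋ + b

codePred : Pred → ℕ
codePred lt = 0
codePred eq = 1

codeLA : LAVar → ℕ
codeLA x = 0
codeLA y = 1

codeC : ∀ {k} → Constraint k → ℕ
codeC (laC R u a v b) = pair 0 (pair (codePred R) (pair (codeLA u) (pair a (pair (codeLA v) b))))
codeC (fbC R p q)     = pair 1 (pair (codePred R) (pair (toℕ p) (toℕ q)))

codeF : ∀ {k} → Formula k → ℕ
codeF (atom c)  = pair 0 (codeC c)
codeF (¬' φ)    = pair 1 (codeF φ)
codeF (φ ∨' ψ)  = pair 2 (pair (codeF φ) (codeF ψ))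
codeF (X' φ)    = pair 3 (codeF φ)
codeF (φ U' ψ)  = pair 4 (pair (codeF φ) (codeF ψ))

codeInstance : (k : ℕ) → Formula k → ℕ
codeInstance k φ = pair k (codeF φ)

Decides : Dom → Program → Set
Decides D P = ∀ (k : ℕ) (φ : Formula k) →
  (Realizable D k φ → Outputs P (codeInstance k φ) 1)
  × (¬ Realizable D k φ → Outputs P (codeInstance k φ) 0)

Undecidable : Dom → Set
Undecidable D = ¬ Σ Program (Decides D)

{-# OPTIONS --safe #-}
module Submission where

-- The environment encodes a run of a machine in the stream x₀ x₁ x₂ …: a clock x₀, x₀ + 1, x₀ + 2, …
-- runs through the even positions and blocks of register values, offset by x₀, fill the odd ones.
-- Equality of registers is directly expressible. For x_b = x_a + 1 the formula demands x_a < x_b and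
-- that y_b does not lie strictly in between, so a system that always plays the correct value catches
-- every false increment, while no move of the system refutes a correct one. Hence the system wins
-- exactly if the machine stops. The future-blind variables only mark even positions and block starts.
--
-- The input q of the machine enters the formula through the single constraint x₁ = X^{2q} x, which
-- equates register 0 with the clock value q. The remaining formula Θ does not depend on q, so that on
-- input q = ⌜Θ⌝ the machine can compute the code of the whole instance with a few pairings. It then
-- runs the supposed decision program on that code and stops if and only if the answer is 0.

open import Defs
open import Data.Nat using (ℕ; zero; suc; _+_; _*_; _/_; _%_; _⊓_; _⊔_; _≤_; _<_; z≤n; s≤s; NonZero; ⌊_/2⌋)
open import Data.Nat.Properties
  using (_≟_; +-comm; +-assoc; +-suc; +-identityʳ; *-comm; +-monoʳ-<; n<1+n;
         ≤-refl; ≤-trans; m≤m⊔n; m≤n⊔m; m⊓n≤n; m≤n⇒m⊓n≡m; m≥n⇒m⊓n≡n; <⇒≤; <-irrefl;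
         suc-injective)
import Data.Nat.Properties as ℕₚ
open import Data.Nat.DivMod
  using (_mod_; m*n%n≡0; m*n/n≡m; [m+kn]%n≡m%n; +-distrib-/-∣ʳ; m<n⇒m/n≡0; m<n⇒m%n≡m)
open import Data.Nat.Divisibility using (_∣_; divides; _∣?_; n∣m*n)
open import Data.Nat.Solver using (module +-*-Solver)
import Data.Integer as ℤ
import Data.Integer.Properties as ℤₚ
open import Data.Fin using (Fin; zero; suc; toℕ; splitAt; _↑ˡ_; _↑ʳ_)
open import Data.Fin.Properties using (toℕ<n; toℕ-injective; toℕ-fromℕ<; splitAt-↑ˡ; splitAt-↑ʳ)
open import Data.List using (List; []; _∷_; _∷ʳ_; _++_; map; length; lookup; foldl; allFin)
open import Data.List.Properties using (length-++; length-map)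
open import Data.List.Relation.Unary.Any using (here; there)
open import Data.List.Relation.Unary.All using (All; []; _∷_)
import Data.List.Relation.Unary.All as All
import Data.List.Relation.Unary.All.Properties as All
open import Data.List.Membership.Propositional using (_∈_)
open import Data.List.Membership.Propositional.Properties using (∈-allFin)
open import Data.Maybe using (Maybe; just; nothing)
open import Data.Product using (_×_; _,_; ∃; proj₁; proj₂)
open import Data.Sum using (_⊎_; inj₁; inj₂; [_,_]′)
open import Data.Empty using (⊥-elim)
open import Data.Unit using (⊤; tt)
open import Function using (_∘_)
open import Relation.Nullary using (¬_; Dec; yes; no; contradiction)
open import Relation.Nullary.Decidable using (decidable-stable)
open import Relation.Binary.Definitions using (tri<; tri≈; tri>)
open import Relation.Binary.PropositionalEquality
  using (_≡_; _≢_; refl; sym; trans; cong; cong₂; subst)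

-- The ordered domains

shift : ∀ D → Carrier D → ℕ → Carrier D
shift ZZ z n = z ℤ.+ ℤ.+ n
shift NN z n = z + n

origin : ∀ D → Carrier D
origin ZZ = ℤ.+ 0
origin NN = 0

eq-intro : ∀ D {a b} → a ≡ b → interp D eq a b
eq-intro ZZ e = e
eq-intro NN e = e

-- The semantics delivers equalities only through negated formulas; decidable equality of the
-- carrier removes the double negation.
eq-elim : ∀ D {a b} → ¬ ¬ interp D eq a b → a ≡ b
eq-elim ZZ {a} {b} = decidable-stable (a ℤ.≟ b)
eq-elim NN {a} {b} = decidable-stable (a ≟ b)

shift-zero : ∀ D z → shift D z 0 ≡ z
shift-zero ZZ z = ℤₚ.+-identityʳ z
shift-zero NN z = +-identityʳ z

shift-< : ∀ D z {m n} → m < n → interp D lt (shift D z m) (shift D z n)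
shift-< ZZ z m<n = ℤₚ.+-monoʳ-< z (ℤ.+<+ m<n)
shift-< NN z m<n = +-monoʳ-< z m<n

lt-irrefl : ∀ D a → ¬ interp D lt a a
lt-irrefl ZZ a = ℤₚ.<-irrefl refl
lt-irrefl NN a = <-irrefl refl

shift-injective : ∀ D z {m n} → shift D z m ≡ shift D z n → m ≡ n
shift-injective D z {m} {n} e with ℕₚ.<-cmp m n
... | tri< m<n _ _ = contradiction (subst (interp D lt _) (sym e) (shift-< D z m<n)) (lt-irrefl D _)
... | tri≈ _ m≡n _ = m≡n
... | tri> _ _ n<m = contradiction (subst (interp D lt _) e (shift-< D z n<m)) (lt-irrefl D _)

-- Discreteness of the order, on which both directions of the successor test rest.
shift-gap : ∀ D z n {b} → interp D lt (shift D z n) b → ¬ interp D lt b (shift D z (suc n))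
shift-gap ZZ z n {b} z+n<b b<z+n' =
  ℤₚ.<-irrefl refl (ℤₚ.<-≤-trans b<z+n' (subst (ℤ._≤ b) 1+[z+n] (ℤₚ.i<j⇒suc[i]≤j z+n<b)))
  where
  1+[z+n] : ℤ.suc (z ℤ.+ ℤ.+ n) ≡ z ℤ.+ ℤ.+ suc n
  1+[z+n] = trans (sym (ℤₚ.+-assoc (ℤ.+ 1) z (ℤ.+ n)))
    (trans (cong (ℤ._+ ℤ.+ n) (ℤₚ.+-comm (ℤ.+ 1) z)) (ℤₚ.+-assoc z (ℤ.+ 1) (ℤ.+ n)))
shift-gap NN z n {b} z+n<b b<z+n' =
  <-irrefl refl (≤-trans b<z+n' (subst (_≤ b) (sym (+-suc z n)) z+n<b))

compare : ∀ D a b → interp D lt a b ⊎ a ≡ b ⊎ interp D lt b a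
compare ZZ a b with ℤₚ.<-cmp a b
... | tri< l _ _ = inj₁ l
... | tri≈ _ e _ = inj₂ (inj₁ e)
... | tri> _ _ g = inj₂ (inj₂ g)
compare NN a b with ℕₚ.<-cmp a b
... | tri< l _ _ = inj₁ l
... | tri≈ _ e _ = inj₂ (inj₁ e)
... | tri> _ _ g = inj₂ (inj₂ g)

-- Formulas describing an error of the environment

⊤' : ∀ {k} → Formula k
⊤' = atom (laC eq x 0 x 0)

_∧'_ : ∀ {k} → Formula k → Formula k → Formula k
φ ∧' ψ = ¬' ((¬' φ) ∨' (¬' ψ))

next : ∀ {k} → ℕ → Formula k → Formula k
next zero    φ = φ
next (suc n) φ = X' next n φ

⋁ : ∀ {k} n → (Fin n → Formula k) → Formula k
⋁ zero    f = ¬' ⊤'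
⋁ (suc n) f = f zero ∨' ⋁ n (f ∘ suc)

sameX : ∀ {k} → ℕ → ℕ → Formula k
sameX a b = atom (laC eq x a x b)

-- The system's value y at the position b, where x is to be incremented or decremented, exposes a gap.
incBad decBad : ∀ {k} → ℕ → ℕ → Formula k
incBad a b = (¬' atom (laC lt x a x b)) ∨' (atom (laC lt x a y b) ∧' atom (laC lt y b x b))
decBad a b = (¬' atom (laC lt x b x a)) ∨' (atom (laC lt x b y b) ∧' atom (laC lt y b x a))

-- The label `ℓ` stands in for counting modulo `L`. If this error is absent, `ℓ` holds at 0 and
-- recurs `L` positions after each occurrence, hence at every multiple of `L`, and `β` fails there.
every : ∀ {k} → Formula k → ℕ → Formula k → Formula k
every ℓ L β = (¬' ℓ) ∨' (⊤' U' (ℓ ∧' ((¬' next L ℓ) ∨' β)))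

-- Soundness and completeness of the error formulas in a model

module Gadgets (D : Dom) {k : ℕ} (σ : Model D k) where

  Holds : ℕ → Formula k → Set
  Holds i φ = _,_⊨_ {D} {k} σ i φ

  ⊤-holds : ∀ i → Holds i ⊤'
  ⊤-holds i = eq-intro D refl

  next-intro : ∀ n φ i → Holds (n + i) φ → Holds i (next n φ)
  next-intro zero    φ i h = h
  next-intro (suc n) φ i h = next-intro n φ (suc i) (subst (λ j → Holds j φ) (sym (+-suc n i)) h)

  next-elim : ∀ n φ i → Holds i (next n φ) → Holds (n + i) φ
  next-elim zero    φ i h = h
  next-elim (suc n) φ i h = subst (λ j → Holds j φ) (+-suc n i) (next-elim n φ (suc i) h)

  ⋁-intro : ∀ i n f s → Holds i (f s) → Holds i (⋁ n f)
  ⋁-intro i (suc n) f zero    h = inj₁ h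
  ⋁-intro i (suc n) f (suc s) h = inj₂ (⋁-intro i n (f ∘ suc) s h)

  ⋁-refute : ∀ i n f → (∀ s → ¬ Holds i (f s)) → ¬ Holds i (⋁ n f)
  ⋁-refute i zero    f h g        = g (⊤-holds i)
  ⋁-refute i (suc n) f h (inj₁ g) = h zero g
  ⋁-refute i (suc n) f h (inj₂ g) = ⋁-refute i n (f ∘ suc) (h ∘ suc) g

  -- Compare `x` at `b` with the correct value. Were it smaller, it would lie strictly between two
  -- consecutive values; were it larger, the correct `y` would lie strictly between the two values
  -- of `x`.
  incBad-sound : ∀ i a b {z v} → σ (i + a) vx ≡ shift D z v → σ (i + b) vy ≡ shift D z (suc v) →
                 ¬ Holds i (incBad a b) → σ (i + b) vx ≡ shift D z (suc v)
  incBad-sound i a b {z} {v} xa yb ok with compare D (σ (i + b) vx) (shift D z (suc v))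
  ... | inj₂ (inj₁ e) = e
  ... | inj₁ l = ⊥-elim (ok (inj₁ λ a<b → shift-gap D z v (subst (λ c → interp D lt c _) xa a<b) l))
  ... | inj₂ (inj₂ g) = ⊥-elim (ok (inj₂ λ where
        (inj₁ n) → n (subst (interp D lt _) (sym yb) (subst (λ c → interp D lt c _) (sym xa) (shift-< D z (n<1+n v))))
        (inj₂ n) → n (subst (λ c → interp D lt c _) (sym yb) g)))

  decBad-sound : ∀ i a b {z v} → σ (i + a) vx ≡ shift D z (suc v) → σ (i + b) vy ≡ shift D z v →
                 ¬ Holds i (decBad a b) → σ (i + b) vx ≡ shift D z v
  decBad-sound i a b {z} {v} xa yb ok with compare D (σ (i + b) vx) (shift D z v)
  ... | inj₂ (inj₁ e) = e
  ... | inj₂ (inj₂ g) = ⊥-elim (ok (inj₁ λ b<a → shift-gap D z v g (subst (interp D lt _) xa b<a)))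
  ... | inj₁ l = ⊥-elim (ok (inj₂ λ where
        (inj₁ n) → n (subst (interp D lt _) (sym yb) l)
        (inj₂ n) → n (subst (interp D lt _) (sym xa) (subst (λ c → interp D lt c _) (sym yb) (shift-< D z (n<1+n v))))))

  private
    no-gap : ∀ i a b (Y : Carrier D) {z v} → σ (i + a) vx ≡ shift D z v → σ (i + b) vx ≡ shift D z (suc v) →
             interp D lt (σ (i + a) vx) Y → ¬ interp D lt Y (σ (i + b) vx)
    no-gap i a b Y {z} {v} xa xb l g =
      shift-gap D z v (subst (λ c → interp D lt c _) xa l) (subst (interp D lt _) xb g)

    increase : ∀ i a b {z v} → σ (i + a) vx ≡ shift D z v → σ (i + b) vx ≡ shift D z (suc v) →
               interp D lt (σ (i + a) vx) (σ (i + b) vx)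
    increase i a b {z} {v} xa xb =
      subst (interp D lt _) (sym xb) (subst (λ c → interp D lt c _) (sym xa) (shift-< D z (n<1+n v)))

  -- Whatever the system plays as `y`, it cannot lie strictly between consecutive values.
  incBad-complete : ∀ i a b {z v} → σ (i + a) vx ≡ shift D z v → σ (i + b) vx ≡ shift D z (suc v) →
                    ¬ Holds i (incBad a b)
  incBad-complete i a b xa xb (inj₁ n) = n (increase i a b xa xb)
  incBad-complete i a b xa xb (inj₂ g) =
    g (inj₁ λ l → g (inj₂ λ u → no-gap i a b (σ (i + b) vy) xa xb l u))

  decBad-complete : ∀ i a b {z v} → σ (i + a) vx ≡ shift D z (suc v) → σ (i + b) vx ≡ shift D z v →
                    ¬ Holds i (decBad a b)
  decBad-complete i a b xa xb (inj₁ n) = n (increase i b a xb xa)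
  decBad-complete i a b xa xb (inj₂ g) =
    g (inj₁ λ l → g (inj₂ λ u → no-gap i b a (σ (i + b) vy) xb xa l u))

  every-sound : ∀ ℓ L β → ¬ Holds 0 (every ℓ L β) → ∀ t → ¬ Holds (t * L) β
  every-sound ℓ L β ok t bad = label t λ h → ok (inj₂ (t * L , both h (inj₂ bad) , λ l _ → ⊤-holds l))
    where
    both : ∀ {A B : Set} → A → B → ¬ (¬ A ⊎ ¬ B)
    both a b (inj₁ n) = n a
    both a b (inj₂ n) = n b
    -- The labels are obtained only up to double negation, since `ok` refutes their absence; this
    -- suffices because the goal is itself a negation.
    label : ∀ t → ¬ ¬ Holds (t * L) ℓ
    label zero    n = ok (inj₁ n)
    label (suc t) n = label t λ h →
      ok (inj₂ (t * L , both h (inj₁ (n ∘ next-elim L ℓ (t * L))) , λ l _ → ⊤-holds l))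

  -- An error sits at a labelled position; `only` makes that a multiple of `L`, where the next label
  -- is present and `β` fails.
  every-complete : ∀ ℓ L β → (∀ t → Holds (t * L) ℓ) → (∀ j → Holds j ℓ → L ∣ j) →
                   (∀ t → ¬ Holds (t * L) β) → ¬ Holds 0 (every ℓ L β)
  every-complete ℓ L β at only ok (inj₁ n) = n (at 0)
  every-complete ℓ L β at only ok (inj₂ (j , g , _)) =
    g (inj₁ λ h → g (inj₂ (error (only j h))))
    where
    error : L ∣ j → ¬ (¬ Holds j (next L ℓ) ⊎ Holds j β)
    error (divides t refl) (inj₁ n) = n (next-intro L ℓ (t * L) (at (suc t)))
    error (divides t refl) (inj₂ b) = ok t b

-- Machines whose single step is a decision tree

data Expr (Reg : Set) : Set where
  copy succ pred : Reg → Expr Reg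

data Tree (Reg : Set) : Set where
  leaf : Maybe (Reg → Expr Reg) → Tree Reg
  ifEq : Reg → Reg → Tree Reg → Tree Reg → Tree Reg

pattern stop     = leaf nothing
pattern assign f = leaf (just f)

branch : ∀ {P A : Set} → Dec P → A → A → A
branch (yes _) a b = a
branch (no _)  a b = b

reach : ∀ {Reg} → Tree Reg → (Reg → ℕ) → Maybe (Reg → Expr Reg)
reach (leaf f)       v = f
reach (ifEq a b t e) v = branch (v a ≟ v b) (reach t v) (reach e v)

-- A relation rather than a function, because `pred` of a register holding 0 has no value.
Gives : ∀ {Reg} → Expr Reg → (Reg → ℕ) → ℕ → Set
Gives (copy r) v m = m ≡ v r
Gives (succ r) v m = m ≡ suc (v r)
Gives (pred r) v m = v r ≡ suc m

Follows : ∀ {Reg} → Tree Reg → (v w : Reg → ℕ) → Set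
Follows T v w = ∃ λ f → reach T v ≡ just f × ∀ r → Gives (f r) v (w r)

-- B is the number of registers; position 2s+1 of the t-th block of length 2B holds register s after t
-- steps. Initial register values are read off the clock.
module Simulation {Reg : Set} (B′ : ℕ) (idx : Reg → Fin (suc B′)) (reg : Fin (suc B′) → Reg)
                  (reg-idx : ∀ r → reg (idx r) ≡ r) (T : Tree Reg) (ini : Fin B′ → ℕ) where

  B L : ℕ
  B = suc B′
  L = B * 2

  pos : Fin B → ℕ
  pos s = suc (toℕ s * 2)

  exprBad : Expr Reg → ℕ → Formula 3
  exprBad (copy r) b = ¬' sameX (pos (idx r)) b
  exprBad (succ r) b = incBad (pos (idx r)) b
  exprBad (pred r) b = decBad (pos (idx r)) b

  nextBad : (Reg → Expr Reg) → Fin B → Formula 3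
  nextBad f s = exprBad (f (reg s)) (L + pos s)

  startBad : Fin B′ → Formula 3
  startBad s = ¬' sameX (pos (suc s)) (ini s * 2)

  -- Stopping counts as an error of the environment, so reaching it wins the play for the system.
  leafBad : Maybe (Reg → Expr Reg) → Formula 3
  leafBad nothing  = ⊤'
  leafBad (just f) = ⋁ B (nextBad f)

  treeBad : Tree Reg → Formula 3
  treeBad (leaf f)       = leafBad f
  treeBad (ifEq a b t e) =
    (sameX (pos (idx a)) (pos (idx b)) ∧' treeBad t) ∨' ((¬' sameX (pos (idx a)) (pos (idx b))) ∧' treeBad e)

  -- Constraints only compare variables, so each label is an inequality against a common reference
  -- variable; this gives three future-blind variables.
  evenLabel blockLabel : Formula 3
  evenLabel  = atom (fbC lt zero (suc zero))
  blockLabel = atom (fbC lt zero (suc (suc zero)))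

  Θ : Formula 3
  Θ = ⋁ B′ startBad ∨' (every evenLabel 2 (incBad 0 2) ∨' every blockLabel L (treeBad T))

  -- The outer double negation lets the system's win be shown by refuting an error-free play,
  -- without locating the error. Position 1 holds register 0, and position `q * 2` the clock value
  -- `q`.
  winning : ℕ → Formula 3
  winning q = ¬' (¬' ((¬' sameX 1 (q * 2)) ∨' Θ))

  start : ℕ → Fin B → ℕ
  start q zero    = q
  start q (suc s) = ini s

  -- `sample V r h` is the entry at position `2h + r`: the parity selects clock or registers, and
  -- `h` is split into block number and register.
  sample : (ℕ → Reg → ℕ) → ℕ → ℕ → ℕ
  sample V zero    h = h
  sample V (suc _) h = V (h / B) (reg (h mod B))

  stream : (ℕ → Reg → ℕ) → ℕ → ℕ
  stream V j = sample V (j % 2) (j / 2)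

  stream-even : ∀ V c → stream V (c * 2) ≡ c
  stream-even V c = cong₂ (sample V) (m*n%n≡0 c 2) (m*n/n≡m c 2)

  private
    quotient : ∀ r q n .{{_ : NonZero n}} → r < n → (r + q * n) / n ≡ q
    quotient r q n r<n = trans (+-distrib-/-∣ʳ r (n∣m*n q)) (cong₂ _+_ (m<n⇒m/n≡0 r<n) (m*n/n≡m q n))

    remainder : ∀ (r : Fin B) q → (toℕ r + q * B) mod B ≡ r
    remainder r q = toℕ-injective (trans (toℕ-fromℕ< _)
      (trans ([m+kn]%n≡m%n (toℕ r) q B) (m<n⇒m%n≡m (toℕ<n r))))

    odd-position : ∀ t b s → t * (b * 2) + suc (s * 2) ≡ suc ((s + t * b) * 2)
    odd-position = solve 3 (λ t b s → t :* (b :* con 2) :+ (con 1 :+ s :* con 2)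
                                      := con 1 :+ (s :+ t :* b) :* con 2) refl
      where open +-*-Solver

  stream-odd : ∀ V t s → stream V (t * L + pos s) ≡ V t (reg s)
  stream-odd V t s = trans (cong (stream V) (odd-position t B (toℕ s)))
    (trans (cong₂ (sample V) ([m+kn]%n≡m%n 1 (toℕ s + t * B) 2) (quotient 1 (toℕ s + t * B) 2 ≤-refl))
      (cong₂ (λ t′ s′ → V t′ (reg s′)) (quotient (toℕ s) t B (toℕ<n s)) (remainder s t)))

  next-block : ∀ t a → suc t * L + a ≡ t * L + (L + a)
  next-block t a = trans (cong (_+ a) (+-comm L (t * L))) (+-assoc (t * L) L a)

  -- Error formulas evaluated at a block that encodes a register state

  module Blocks (D : Dom) (σ : Model D 3) (z : Carrier D) where
    open Gadgets D σ

    Reads : ℕ → (Reg → ℕ) → Set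
    Reads i v = ∀ s → σ (i + pos s) vx ≡ shift D z (v (reg s))

    Reads′ : ℕ → (Reg → ℕ) → Set
    Reads′ i v = ∀ r → σ (i + pos (idx r)) vx ≡ shift D z (v r)

    byReg : ∀ {i v} → Reads i v → Reads′ i v
    byReg {v = v} h r = trans (h (idx r)) (cong (shift D z ∘ v) (reg-idx r))

    same : ∀ {i v} → Reads′ i v → ∀ a b → v a ≡ v b → Holds i (sameX (pos (idx a)) (pos (idx b)))
    same h a b e = eq-intro D (trans (h a) (trans (cong (shift D z) e) (sym (h b))))

    different : ∀ {i v} → Reads′ i v → ∀ a b → v a ≢ v b → ¬ Holds i (sameX (pos (idx a)) (pos (idx b)))
    different h a b n e =
      n (shift-injective D z (trans (sym (h a)) (trans (eq-elim D λ k → k e) (h b))))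

    treeBad-intro : ∀ {i v} → Reads′ i v → ∀ t → Holds i (leafBad (reach t v)) → Holds i (treeBad t)
    treeBad-intro h (leaf f) bad = bad
    treeBad-intro {v = v} h (ifEq a b t e) bad with v a ≟ v b
    ... | yes p = inj₁ λ where (inj₁ n) → n (same h a b p)
                               (inj₂ n) → n (treeBad-intro h t bad)
    ... | no ¬p = inj₂ λ where (inj₁ n) → n (different h a b ¬p)
                               (inj₂ n) → n (treeBad-intro h e bad)

    treeBad-elim : ∀ {i v} → Reads′ i v → ∀ t → ¬ Holds i (leafBad (reach t v)) → ¬ Holds i (treeBad t)
    treeBad-elim h (leaf f) ok bad = ok bad
    treeBad-elim {v = v} h (ifEq a b t e) ok bad with v a ≟ v b | bad
    ... | yes p | inj₁ g = g (inj₂ (treeBad-elim h t ok))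
    ... | yes p | inj₂ g = g (inj₁ λ n → n (same h a b p))
    ... | no ¬p | inj₁ g = g (inj₁ (different h a b ¬p))
    ... | no ¬p | inj₂ g = g (inj₂ (treeBad-elim h e ok))

    exprBad-sound : ∀ {i v m} b → Reads′ i v → ∀ e → Gives e v m → σ (i + b) vy ≡ shift D z m →
                    ¬ Holds i (exprBad e b) → σ (i + b) vx ≡ shift D z m
    exprBad-sound b h (copy r) refl yb ok = trans (sym (eq-elim D ok)) (h r)
    exprBad-sound {i} b h (succ r) refl yb ok = incBad-sound i _ b (h r) yb ok
    exprBad-sound {i} b h (pred r) e yb ok =
      decBad-sound i _ b (trans (h r) (cong (shift D z) e)) yb ok

    exprBad-complete : ∀ {i v m} b → Reads′ i v → ∀ e → Gives e v m → σ (i + b) vx ≡ shift D z m →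
                       ¬ Holds i (exprBad e b)
    exprBad-complete b h (copy r) refl xb ok = ok (eq-intro D (trans (h r) (sym xb)))
    exprBad-complete {i} b h (succ r) refl xb = incBad-complete i _ b (h r) xb
    exprBad-complete {i} b h (pred r) e xb =
      decBad-complete i _ b (trans (h r) (cong (shift D z) e)) xb

  -- The two strategies: a stopping run and an endless run

  module _ (D : Dom) (q : ℕ) (V : ℕ → Reg → ℕ) (V-start : ∀ s → V 0 (reg s) ≡ start q s) where

    -- The offset of the encoding. In round 0 the history is empty and the offset is the current
    -- move.
    first : List (Valuation D 3) → EMove D 3 → Carrier D
    first []      e = e ex
    first (v ∷ _) e = v vx

    -- After round 0 the environment's moves are ignored: the system plays what a faithful encoding
    -- with the same offset would contain.
    honest : Strategy D 3
    honest h e sy = shift D (first h e) (stream V (length h))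

    length-history : ∀ str (em : ℕ → EMove D 3) n → length (history {D} {3} str em n) ≡ n
    length-history str em zero    = refl
    length-history str em (suc n) = trans (length-++ (history {D} {3} str em n))
      (trans (+-comm _ 1) (cong suc (length-history str em n)))

    first-history : ∀ (em : ℕ → EMove D 3) n e → n ≢ 0 → first (history honest em n) e ≡ em 0 ex
    first-history em zero          e n≢0 = contradiction refl n≢0
    first-history em (suc zero)    e _   = refl
    first-history em (suc (suc n)) e _   =
      trans (first-∷ʳ (history honest em n) _ _ e e) (first-history em (suc n) e λ ())
      where
      first-∷ʳ : ∀ h v v′ e e′ → first ((h ∷ʳ v) ∷ʳ v′) e ≡ first (h ∷ʳ v) e′
      first-∷ʳ []      v v′ e e′ = refl
      first-∷ʳ (_ ∷ _) v v′ e e′ = refl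

    honest-y : ∀ em n → play honest em n vy ≡ shift D (em 0 ex) (stream V n)
    honest-y em zero    = refl
    honest-y em (suc n) = cong₂ (shift D) (first-history em (suc n) (em (suc n)) λ ())
      (cong (stream V) (length-history honest em (suc n)))

    -- Against `honest`, an environment without errors is forced, block by block, to spell out the
    -- run. At the stopping block `treeBad` then holds, a contradiction.
    realizable : (∀ t → reach T (V t) ≡ nothing ⊎ Follows T (V t) (V (suc t))) →
                 ∀ t → reach T (V t) ≡ nothing → Realizable D 3 (winning q)
    realizable run t stopped = honest , λ em → wins em
      where
      module _ (em : ℕ → EMove D 3) where
        z : Carrier D
        z = em 0 ex
        σ : Model D 3
        σ = play honest em
        open Gadgets D σ
        open Blocks D σ z

        wins : ¬ ¬ Holds 0 ((¬' sameX 1 (q * 2)) ∨' Θ)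
        wins ok = ⊥-elim (halt t stopped)
          where
          clockOk : ∀ c → ¬ Holds (c * 2) (incBad 0 2)
          clockOk = every-sound evenLabel 2 (incBad 0 2) (ok ∘ inj₂ ∘ inj₂ ∘ inj₁)

          treeOk : ∀ t → ¬ Holds (t * L) (treeBad T)
          treeOk = every-sound blockLabel L (treeBad T) (ok ∘ inj₂ ∘ inj₂ ∘ inj₂)

          clock : ∀ c → σ (c * 2) vx ≡ shift D z c
          clock zero    = sym (shift-zero D z)
          clock (suc c) = subst (λ j → σ j vx ≡ shift D z (suc c)) (+-comm (c * 2) 2)
            (incBad-sound (c * 2) 0 2
              (trans (cong (λ j → σ j vx) (+-identityʳ (c * 2))) (clock c))
              (trans (cong (λ j → σ j vy) (+-comm (c * 2) 2))
                (trans (honest-y em (suc c * 2)) (cong (shift D z) (stream-even V (suc c)))))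
              (clockOk c))

          initially : Reads 0 (V 0)
          initially zero    = trans (eq-elim D (ok ∘ inj₁))
            (trans (clock q) (cong (shift D z) (sym (V-start zero))))
          initially (suc s) = trans (eq-elim D λ n → ok (inj₂ (inj₁ (⋁-intro 0 B′ startBad s n))))
            (trans (clock (ini s)) (cong (shift D z) (sym (V-start (suc s)))))

          -- Mutual induction: block `suc t` is checked against block `t` only if the machine has
          -- not stopped there, and `halt t` derives this from `reads t`.
          reads : ∀ t → Reads (t * L) (V t)
          halt : ∀ t → reach T (V t) ≢ nothing

          reads zero    = initially
          reads (suc t) s with run t
          ... | inj₁ stopped = ⊥-elim (halt t stopped)
          ... | inj₂ (f , reached , gives) = subst (λ j → σ j vx ≡ shift D z (V (suc t) (reg s)))
            (sym (next-block t (pos s)))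
            (exprBad-sound {t * L} (L + pos s) (byReg {t * L} (reads t)) (f (reg s)) (gives (reg s))
              (trans (cong (λ j → σ j vy) (sym (next-block t (pos s))))
                (trans (honest-y em (suc t * L + pos s)) (cong (shift D z) (stream-odd V (suc t) s))))
              λ bad → treeOk t (treeBad-intro (byReg {t * L} (reads t)) T
                (subst (Holds (t * L) ∘ leafBad) (sym reached) (⋁-intro (t * L) B (nextBad f) s bad))))

          halt t stopped = treeOk t (treeBad-intro (byReg {t * L} (reads t)) T
            (subst (Holds (t * L) ∘ leafBad) (sym stopped) (⊤-holds (t * L))))

    mark : ∀ d → ℕ → ℕ
    mark d j = branch (d ∣? j) 1 0

    faithful : ℕ → EMove D 3
    faithful j ex                    = shift D (origin D) (stream V j)
    faithful j (ew zero)             = shift D (origin D) 0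
    faithful j (ew (suc zero))       = shift D (origin D) (mark 2 j)
    faithful j (ew (suc (suc zero))) = shift D (origin D) (mark L j)

    mark-at : ∀ d t → interp D lt (shift D (origin D) 0) (shift D (origin D) (mark d (t * d)))
    mark-at d t with d ∣? (t * d)
    ... | yes _ = shift-< D (origin D) (s≤s z≤n)
    ... | no n  = contradiction (n∣m*n t) n

    mark-only : ∀ d j → interp D lt (shift D (origin D) 0) (shift D (origin D) (mark d j)) → d ∣ j
    mark-only d j l with d ∣? j
    ... | yes p = p
    ... | no _  = contradiction l (lt-irrefl D _)

    -- One fixed sequence of environment moves beats every strategy: `faithful` contains no error,
    -- and no choice of `y` can produce one.
    unrealizable : (∀ t → Follows T (V t) (V (suc t))) → ¬ Realizable D 3 (winning q)
    unrealizable run (str , win) = win faithful λ where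
        (inj₁ n)               → n (initially zero)
        (inj₂ (inj₁ n))        → ⋁-refute 0 B′ startBad (λ s n → n (initially (suc s))) n
        (inj₂ (inj₂ (inj₁ n))) → every-complete evenLabel 2 (incBad 0 2) (mark-at 2) (mark-only 2) clockOk n
        (inj₂ (inj₂ (inj₂ n))) → every-complete blockLabel L (treeBad T) (mark-at L) (mark-only L) treeOk n
      where
      σ : Model D 3
      σ = play str faithful
      open Gadgets D σ
      open Blocks D σ (origin D)

      clock : ∀ c → σ (c * 2) vx ≡ shift D (origin D) c
      clock c = cong (shift D (origin D)) (stream-even V c)

      reads : ∀ t → Reads (t * L) (V t)
      reads t s = cong (shift D (origin D)) (stream-odd V t s)

      initially : ∀ s → Holds 0 (sameX (pos s) (start q s * 2))
      initially s = eq-intro D (trans (reads 0 s)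
        (trans (cong (shift D (origin D)) (V-start s)) (sym (clock (start q s)))))

      clockOk : ∀ c → ¬ Holds (c * 2) (incBad 0 2)
      clockOk c = incBad-complete (c * 2) 0 2
        (trans (cong (λ j → σ j vx) (+-identityʳ (c * 2))) (clock c))
        (trans (cong (λ j → σ j vx) (+-comm (c * 2) 2)) (clock (suc c)))

      treeOk : ∀ t → ¬ Holds (t * L) (treeBad T)
      treeOk t with run t
      ... | f , reached , gives = treeBad-elim (byReg {t * L} (reads t)) T
        (subst (λ l → ¬ Holds (t * L) (leafBad l)) (sym reached)
          (⋁-refute (t * L) B (nextBad f) λ s → exprBad-complete {t * L} (L + pos s) (byReg {t * L} (reads t)) (f (reg s))
            (gives (reg s)) (trans (cong (λ j → σ j vx) (sym (next-block t (pos s)))) (reads (suc t) s))))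

-- Computing the pairing function by walking down the diagonals

half-add : ∀ k m → ⌊ k * 2 + m /2⌋ ≡ k + ⌊ m /2⌋
half-add zero    m = refl
half-add (suc k) m = cong suc (half-add k m)

pair-up : ∀ u v → pair u (suc v) ≡ suc (pair (suc u) v)
pair-up u v rewrite +-suc u v = +-suc ⌊ suc (u + v) * suc (suc (u + v)) /2⌋ v

-- Consecutive triangular numbers: half of `(u + 1)(u + 2)` is `u + 1` plus half of `u(u + 1)`.
pair-wrap : ∀ u → pair (suc u) 0 ≡ suc (pair 0 u)
pair-wrap u rewrite +-identityʳ u | +-identityʳ ⌊ suc u * suc (suc u) /2⌋ =
  trans (cong ⌊_/2⌋ (expand u)) (trans (half-add (suc u) (u * suc u)) (cong suc (+-comm u _)))
  where
  open +-*-Solver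
  expand : ∀ u → suc u * suc (suc u) ≡ suc u * 2 + u * suc u
  expand = solve 1 (λ u → (con 1 :+ u) :* (con 2 :+ u) := (con 1 :+ u) :* con 2 :+ u :* (con 1 :+ u)) refl

-- Abstract copies of the coding functions: unfolding nested codes is exponential in their depth.
abstract
  ⟨_,_⟩ : ℕ → ℕ → ℕ
  ⟨ a , b ⟩ = pair a b

  ⟨,⟩-zero : ⟨ 0 , 0 ⟩ ≡ 0
  ⟨,⟩-zero = refl

  ⟨,⟩-up : ∀ u v → ⟨ u , suc v ⟩ ≡ suc ⟨ suc u , v ⟩
  ⟨,⟩-up = pair-up

  ⟨,⟩-wrap : ∀ u → ⟨ suc u , 0 ⟩ ≡ suc ⟨ 0 , u ⟩
  ⟨,⟩-wrap = pair-wrap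

  formulaCode : ∀ {k} → Formula k → ℕ
  formulaCode = codeF

  decides-code : ∀ {D P} → Decides D P → ∀ k φ →
                 (Realizable D k φ → Outputs P ⟨ k , formulaCode φ ⟩ 1) ×
                 (¬ Realizable D k φ → Outputs P ⟨ k , formulaCode φ ⟩ 0)
  decides-code decides = decides

  code-¬ : ∀ {k} (φ : Formula k) → formulaCode (¬' φ) ≡ ⟨ 1 , formulaCode φ ⟩
  code-¬ φ = refl

  code-∨ : ∀ {k} (φ ψ : Formula k) → formulaCode (φ ∨' ψ) ≡ ⟨ 2 , ⟨ formulaCode φ , formulaCode ψ ⟩ ⟩
  code-∨ φ ψ = refl

  code-sameX : ∀ k a b → formulaCode {k} (sameX a b) ≡ ⟨ 0 , ⟨ 0 , ⟨ 1 , ⟨ 0 , ⟨ a , ⟨ 0 , b ⟩ ⟩ ⟩ ⟩ ⟩ ⟩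
  code-sameX k a b = refl

-- The code of the instance as a function of the look-ahead `b` and the code `c` of `Θ`, the only
-- parts that the machine takes from its input.
instanceCode : ℕ → ℕ → ℕ
instanceCode b c =
  ⟨ 3 , ⟨ 1 , ⟨ 1 , ⟨ 2 , ⟨ ⟨ 1 , ⟨ 0 , ⟨ 0 , ⟨ 1 , ⟨ 0 , ⟨ 1 , ⟨ 0 , b ⟩ ⟩ ⟩ ⟩ ⟩ ⟩ ⟩ , c ⟩ ⟩ ⟩ ⟩ ⟩

code-winning : ∀ b (φ : Formula 3) →
               ⟨ 3 , formulaCode (¬' (¬' ((¬' sameX 1 b) ∨' φ))) ⟩ ≡ instanceCode b (formulaCode φ)
code-winning b φ = cong ⟨ 3 ,_⟩
  (trans (code-¬ _) (cong ⟨ 1 ,_⟩ (trans (code-¬ _) (cong ⟨ 1 ,_⟩ (trans (code-∨ _ φ) (cong ⟨ 2 ,_⟩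
    (cong ⟨_, formulaCode φ ⟩ (trans (code-¬ _) (cong ⟨ 1 ,_⟩ (code-sameX 3 1 b))))))))))

-- Machines that compute a pairing expression of their input and then run a counter program on it

nth-toℕ : ∀ {A : Set} (xs : List A) i → nth xs (toℕ i) ≡ just (lookup xs i)
nth-toℕ (a ∷ xs) zero    = refl
nth-toℕ (a ∷ xs) (suc i) = nth-toℕ xs i

nth-just : ∀ {A : Set} {a} (xs : List A) p → nth xs p ≡ just a → ∃ λ i → p ≡ toℕ i × lookup xs i ≡ a
nth-just (a ∷ xs) zero    refl = zero , refl , refl
nth-just (a ∷ xs) (suc p) e with nth-just xs p e
... | i , p≡i , found = suc i , cong suc p≡i , found

nth-< : ∀ {A : Set} {a} (xs : List A) p → nth xs p ≡ just a → p < length xs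
nth-< (_ ∷ xs) zero    e = s≤s z≤n
nth-< (_ ∷ xs) (suc p) e = s≤s (nth-< xs p e)

nth-nothing : ∀ {A : Set} (xs : List A) p → nth xs p ≡ nothing → length xs ≤ p
nth-nothing []       p       e = z≤n
nth-nothing (a ∷ xs) (suc p) e = s≤s (nth-nothing xs p e)

nth-map-++ : ∀ {A C : Set} {a} (f : A → C) xs ys p → nth xs p ≡ just a → nth (map f xs ++ ys) p ≡ just (f a)
nth-map-++ f (a ∷ xs) ys zero    refl = refl
nth-map-++ f (a ∷ xs) ys (suc p) e    = nth-map-++ f xs ys p e

nth-length : ∀ {A C : Set} (f : A → C) xs b bs → nth (map f xs ++ b ∷ bs) (length xs) ≡ just b
nth-length f []       b bs = refl
nth-length f (a ∷ xs) b bs = nth-length f xs b bs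

All-nth : ∀ {A : Set} {Q : A → Set} {a xs} → All Q xs → ∀ p → nth xs p ≡ just a → Q a
All-nth (q ∷ qs) zero    refl = q
All-nth (q ∷ qs) (suc p) e    = All-nth qs p e

-- The fresh operand of the next pairing: a literal goes to the left of the value built so far, the
-- input to its right.
data Load : Set where
  literal : ℕ → Load
  input   : Load

-- In one step a register can only receive a copy, successor or predecessor of an old value.
-- Doubling and pairing are therefore loops that leave `pc` in place until they finish.
data Op : Set where
  copyInput double : Op
  pairThen         : Load → Op
  pairLaunch       : Op
  incr             : ℕ → Op
  decr             : ℕ → ℕ → Op
  verdict          : Op

record State : Set where
  constructor ⟪_,_,_,_,_,_⟫
  field
    pc inp u v z : ℕ
    regs         : ℕ → ℕ
open State

-- z + pair u v is invariant.
pairLoop : (State → State) → State → State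
pairLoop k ⟪ p , n , u     , suc v , z , g ⟫ = ⟪ p , n , suc u , v , suc z , g ⟫
pairLoop k ⟪ p , n , suc u , zero  , z , g ⟫ = ⟪ p , n , 0 , u , suc z , g ⟫
pairLoop k ⟪ p , n , zero  , zero  , z , g ⟫ = k ⟪ p , n , 0 , 0 , z , g ⟫

load : Load → State → State
load (literal c) ⟪ p , n , u , v , z , g ⟫ = ⟪ suc p , n , c , z , 0 , g ⟫
load input       ⟪ p , n , u , v , z , g ⟫ = ⟪ suc p , n , z , n , 0 , g ⟫

launch : State → State
launch ⟪ p , n , u , v , z , g ⟫ = ⟪ suc p , n , u , v , z , proj₂ (initConfig z) ⟫

decrement : ℕ → ℕ → ℕ → State → State
decrement r l zero    ⟪ p , n , u , v , z , g ⟫ = ⟪ l , n , u , v , z , g ⟫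
decrement r l (suc m) ⟪ p , n , u , v , z , g ⟫ = ⟪ suc p , n , u , v , z , update g r m ⟫

exec : Op → State → State
exec copyInput    ⟪ p , n , u , v , z , g ⟫     = ⟪ suc p , n , n , v , n , g ⟫
exec double       ⟪ p , n , zero , v , z , g ⟫  = ⟪ suc p , n , 0 , v , z , g ⟫
exec double       ⟪ p , n , suc u , v , z , g ⟫ = ⟪ p , n , u , v , suc z , g ⟫
exec (pairThen a) s                             = pairLoop (load a) s
exec pairLaunch   s                             = pairLoop launch s
exec (incr r)     ⟪ p , n , u , v , z , g ⟫     = ⟪ suc p , n , u , v , z , update g r (suc (g r)) ⟫
exec (decr r l)   s                             = decrement r l (regs s r) s
exec verdict      s                             = s

execAt : Maybe Op → State → State
execAt nothing   s = s
execAt (just op) s = exec op s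

-- Decision trees for the operations

module Machine (R′ : ℕ) (op₀ : Op) (ops : List Op) where

  code : List Op
  code = op₀ ∷ ops

  R K : ℕ
  R = suc R′
  K = length code

  -- Trees refer to registers only, so addresses and literals must be stored: `rC i` holds the
  -- constant `i` throughout.
  data Register : Set where
    rN rU rV rZ rPC : Register
    rP              : Fin R → Register
    rC              : Fin K → Register

  value : State → Register → ℕ
  value s rN     = inp s
  value s rU     = u s
  value s rV     = v s
  value s rZ     = z s
  value s rPC    = pc s
  value s (rP i) = regs s (toℕ i)
  value s (rC i) = toℕ i

  idx : Register → Fin (5 + (R + K))
  idx rN     = zero
  idx rU     = suc zero
  idx rV     = suc (suc zero)
  idx rZ     = suc (suc (suc zero))
  idx rPC    = suc (suc (suc (suc zero)))
  idx (rP i) = suc (suc (suc (suc (suc (i ↑ˡ K)))))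
  idx (rC i) = suc (suc (suc (suc (suc (R ↑ʳ i)))))

  reg : Fin (5 + (R + K)) → Register
  reg zero                                = rN
  reg (suc zero)                          = rU
  reg (suc (suc zero))                    = rV
  reg (suc (suc (suc zero)))              = rZ
  reg (suc (suc (suc (suc zero))))        = rPC
  reg (suc (suc (suc (suc (suc s)))))     = [ rP , rC ]′ (splitAt R s)

  reg-idx : ∀ r → reg (idx r) ≡ r
  reg-idx rN     = refl
  reg-idx rU     = refl
  reg-idx rV     = refl
  reg-idx rZ     = refl
  reg-idx rPC    = refl
  reg-idx (rP i) = cong [ rP , rC ]′ (splitAt-↑ˡ R i K)
  reg-idx (rC i) = cong [ rP , rC ]′ (splitAt-↑ʳ R K i)

  Ex : Set
  Ex = Expr Register

  update-all : (n u v z p : Ex) → (Fin R → Ex) → Register → Ex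
  update-all n u v z p g rN     = n
  update-all n u v z p g rU     = u
  update-all n u v z p g rV     = v
  update-all n u v z p g rZ     = z
  update-all n u v z p g rPC    = p
  update-all n u v z p g (rP i) = g i
  update-all n u v z p g (rC i) = copy (rC i)

  keep : Fin R → Ex
  keep i = copy (rP i)

  zeroC : Register
  zeroC = rC zero

  setting : (u v z p : Ex) → (Fin R → Ex) → Tree Register
  setting u v z p g = assign (update-all (copy rN) u v z p g)

  move : Ex → (Fin R → Ex) → Tree Register
  move = setting (copy rU) (copy rV) (copy rZ)

  pairLoopTree : Tree Register → Tree Register
  pairLoopTree k =
    ifEq rV zeroC
      (ifEq rU zeroC k (setting (copy zeroC) (pred rU) (succ rZ) (copy rPC) keep))
      (setting (succ rU) (pred rV) (succ rZ) (copy rPC) keep)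

  loadTree : Load → Tree Register
  loadTree (literal c) = setting (copy (rC (c mod K))) (copy rZ) (copy zeroC) (succ rPC) keep
  loadTree input       = setting (copy rZ) (copy rN) (copy zeroC) (succ rPC) keep

  launchTree : Tree Register
  launchTree = move (succ rPC) λ where zero    → copy rZ
                                       (suc _) → copy zeroC

  treeOf : Op → Tree Register
  treeOf copyInput    = setting (copy rN) (copy rV) (copy rN) (succ rPC) keep
  treeOf double       = ifEq rU zeroC (move (succ rPC) keep)
                                      (setting (pred rU) (copy rV) (succ rZ) (copy rPC) keep)
  treeOf (pairThen a) = pairLoopTree (loadTree a)
  treeOf pairLaunch   = pairLoopTree launchTree
  treeOf (incr r)     = move (succ rPC) λ i → branch (r ≟ toℕ i) (succ (rP i)) (copy (rP i))
  treeOf (decr r l)   = ifEq (rP (r mod R)) zeroC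
                          (move (copy (rC (l mod K))) keep)
                          (move (succ rPC) λ i → branch (r ≟ toℕ i) (pred (rP i)) (copy (rP i)))
  treeOf verdict      = ifEq (rP zero) zeroC stop (move (copy rPC) keep)

  -- Makes the reductions modulo `R` and `K` in `loadTree` and `treeOf` the identity.
  Fits : Op → Set
  Fits (pairThen (literal c)) = c < K
  Fits (decr r l)             = r < R × l < K
  Fits _                      = ⊤

  dispatch : List (Fin K) → Tree Register
  -- A `pc` outside the code idles, in agreement with `execAt nothing`.
  dispatch []       = move (copy rPC) keep
  dispatch (i ∷ is) = ifEq rPC (rC i) (treeOf (lookup code i)) (dispatch is)

  tree : Tree Register
  tree = dispatch (allFin K)

  advance : State → State
  advance s = execAt (nth code (pc s)) s

  obey : ∀ {n u v z p g} s s′ → Gives n (value s) (inp s′) → Gives u (value s) (State.u s′) →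
         Gives v (value s) (State.v s′) → Gives z (value s) (State.z s′) → Gives p (value s) (pc s′) →
         (∀ i → Gives (g i) (value s) (regs s′ (toℕ i))) →
         ∀ r → Gives (update-all n u v z p g r) (value s) (value s′ r)
  obey s s′ n u v z p g rN     = n
  obey s s′ n u v z p g rU     = u
  obey s s′ n u v z p g rV     = v
  obey s s′ n u v z p g rZ     = z
  obey s s′ n u v z p g rPC    = p
  obey s s′ n u v z p g (rP i) = g i
  obey s s′ n u v z p g (rC i) = refl

  toℕ-mod : ∀ {m} n .{{_ : NonZero n}} → m < n → toℕ (m mod n) ≡ m
  toℕ-mod n m<n = trans (toℕ-fromℕ< _) (m<n⇒m%n≡m m<n)

  branch-yes : ∀ {P A : Set} (d : Dec P) {a b : A} → P → branch d a b ≡ a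
  branch-yes (yes _) p = refl
  branch-yes (no ¬p) p = contradiction p ¬p

  branch-no : ∀ {P A : Set} (d : Dec P) {a b : A} → ¬ P → branch d a b ≡ b
  branch-no (yes p) ¬p = contradiction p ¬p
  branch-no (no _)  ¬p = refl

  pairLoop-follows : ∀ T k → (∀ p n z g → let s = ⟪ p , n , 0 , 0 , z , g ⟫ in Follows T (value s) (value (k s))) →
                     ∀ s → Follows (pairLoopTree T) (value s) (value (pairLoop k s))
  pairLoop-follows T k h s@(⟪ p , n , u , suc v , z , g ⟫) =
    _ , refl , obey s (pairLoop k s) refl refl refl refl refl λ _ → refl
  pairLoop-follows T k h s@(⟪ p , n , suc u , zero , z , g ⟫) =
    _ , refl , obey s (pairLoop k s) refl refl refl refl refl λ _ → refl
  pairLoop-follows T k h ⟪ p , n , zero , zero , z , g ⟫ = h p n z g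

  load-follows : ∀ a → Fits (pairThen a) → ∀ s → Follows (loadTree a) (value s) (value (load a s))
  load-follows (literal c) c<K s =
    _ , refl , obey s (load (literal c) s) refl (sym (toℕ-mod K c<K)) refl refl refl λ _ → refl
  load-follows input       _   s = _ , refl , obey s (load input s) refl refl refl refl refl λ _ → refl

  launch-follows : ∀ s → Follows launchTree (value s) (value (launch s))
  launch-follows s = _ , refl , obey s (launch s) refl refl refl refl refl
    λ where zero    → refl
            (suc _) → refl

  decr-follows : ∀ r l s → Fits (decr r l) → Follows (treeOf (decr r l)) (value s) (value (exec (decr r l) s))
  decr-follows r l s (r<R , l<K) with regs s r in eq
  ... | zero  = _ , branch-yes (_ ≟ 0) (trans (cong (regs s) (toℕ-mod R r<R)) eq)
                  , obey s (decrement r l 0 s) refl refl refl refl (sym (toℕ-mod K l<K)) λ _ → refl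
  ... | suc m = _ , branch-no (_ ≟ 0) (λ e →
                      ℕₚ.1+n≢0 (trans (sym eq) (trans (cong (regs s) (sym (toℕ-mod R r<R))) e)))
                  , obey s (decrement r l (suc m) s) refl refl refl refl refl entry
    where
    entry : ∀ i → Gives (branch (r ≟ toℕ i) (pred (rP i)) (copy (rP i))) (value s) (update (regs s) r m (toℕ i))
    entry i with r ≟ toℕ i
    ... | yes refl = eq
    ... | no _     = refl

  exec-follows : ∀ op s → Fits op → (op ≡ verdict → regs s 0 ≢ 0) →
                 Follows (treeOf op) (value s) (value (exec op s))
  exec-follows copyInput s _ _ = _ , refl , obey s (exec copyInput s) refl refl refl refl refl λ _ → refl
  exec-follows double s@(⟪ p , n , zero , v , z , g ⟫) _ _ =
    _ , refl , obey s (exec double s) refl refl refl refl refl λ _ → refl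
  exec-follows double s@(⟪ p , n , suc u , v , z , g ⟫) _ _ =
    _ , refl , obey s (exec double s) refl refl refl refl refl λ _ → refl
  exec-follows (pairThen a) s fits _ =
    pairLoop-follows (loadTree a) (load a) (λ p n z g → load-follows a fits _) s
  exec-follows pairLaunch s _ _ =
    pairLoop-follows launchTree launch (λ p n z g → launch-follows _) s
  exec-follows (incr r) s _ _ = _ , refl , obey s (exec (incr r) s) refl refl refl refl refl entry
    where
    entry : ∀ i → Gives (branch (r ≟ toℕ i) (succ (rP i)) (copy (rP i))) (value s)
                        (update (regs s) r (suc (regs s r)) (toℕ i))
    entry i with r ≟ toℕ i
    ... | yes refl = refl
    ... | no _     = refl
  exec-follows (decr r l) s fits _ = decr-follows r l s fits
  exec-follows verdict s _ nonzero =
    _ , branch-no (regs s 0 ≟ 0) (nonzero refl) , obey s s refl refl refl refl refl λ _ → refl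

  Accepts : State → Set
  Accepts s = nth code (pc s) ≡ just verdict × regs s 0 ≡ 0

  dispatch-hit : ∀ {i is} s → i ∈ is → pc s ≡ toℕ i →
                 reach (dispatch is) (value s) ≡ reach (treeOf (lookup code i)) (value s)
  dispatch-hit {i} {j ∷ is} s i∈ e with pc s ≟ toℕ j
  ... | yes e′ = cong (λ j → reach (treeOf (lookup code j)) (value s)) (toℕ-injective (trans (sym e′) e))
  dispatch-hit {i} {j ∷ is} s (here refl) e | no n = contradiction e n
  dispatch-hit {i} {j ∷ is} s (there i∈)  e | no n = dispatch-hit s i∈ e

  dispatch-miss : ∀ is s → (∀ (i : Fin K) → pc s ≢ toℕ i) →
                  reach (dispatch is) (value s) ≡ reach (dispatch []) (value s)
  dispatch-miss []       s n = refl
  dispatch-miss (i ∷ is) s n = trans (branch-no (pc s ≟ toℕ i) (n i)) (dispatch-miss is s n)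

  tree-reach : ∀ {op} s → nth code (pc s) ≡ just op → reach tree (value s) ≡ reach (treeOf op) (value s)
  tree-reach s found with nth-just code (pc s) found
  ... | i , e , refl = dispatch-hit s (∈-allFin i) e

  accept-stops : ∀ s → Accepts s → reach tree (value s) ≡ nothing
  accept-stops s (found , e) = trans (tree-reach s found) (branch-yes (regs s 0 ≟ 0) e)

  progress : All Fits code → ∀ s → Accepts s ⊎ Follows tree (value s) (value (advance s))
  progress fits s with nth code (pc s) in found
  ... | nothing = inj₂ (_ , dispatch-miss (allFin K) s missing , obey s s refl refl refl refl refl λ _ → refl)
    where
    missing : ∀ (i : Fin K) → pc s ≢ toℕ i
    missing i e with trans (sym found) (trans (cong (nth code) e) (nth-toℕ code i))
    ... | ()
  ... | just op with op-verdict? op (regs s 0)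
    where
    op-verdict? : ∀ op m → (op ≡ verdict × m ≡ 0) ⊎ (op ≡ verdict → m ≢ 0)
    op-verdict? verdict zero = inj₁ (refl , refl)
    op-verdict? verdict (suc m) = inj₂ λ _ ()
    op-verdict? copyInput m = inj₂ λ ()
    op-verdict? double m = inj₂ λ ()
    op-verdict? (pairThen _) m = inj₂ λ ()
    op-verdict? pairLaunch m = inj₂ λ ()
    op-verdict? (incr _) m = inj₂ λ ()
    op-verdict? (decr _ _) m = inj₂ λ ()
  ...   | inj₁ (refl , e) = inj₁ (refl , e)
  ...   | inj₂ n with exec-follows op s (All-nth fits (pc s) found) n
  ...     | f , reached , gives = inj₂ (f , trans (tree-reach s found) reached , gives)

  -- Runs of the machine

  steps : ℕ → State → State
  steps zero    s = s
  steps (suc t) s = advance (steps t s)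

  steps-+ : ∀ j k s → steps (j + k) s ≡ steps j (steps k s)
  steps-+ zero    k s = refl
  steps-+ (suc j) k s = cong advance (steps-+ j k s)

  steps-fixed : ∀ t {s} → advance s ≡ s → steps t s ≡ s
  steps-fixed zero    e = refl
  steps-fixed (suc t) e = trans (cong advance (steps-fixed t e)) e

  -- Both states equal the one after `j + k` steps.
  fixed-unique : ∀ j k s → advance (steps j s) ≡ steps j s → advance (steps k s) ≡ steps k s →
                 steps j s ≡ steps k s
  fixed-unique j k s fj fk = trans (sym (trans (steps-+ k j s) (steps-fixed k fj)))
    (trans (cong (λ t → steps t s) (+-comm k j)) (trans (steps-+ j k s) (steps-fixed j fk)))

  verdict-fixed : ∀ s → nth code (pc s) ≡ just verdict → advance s ≡ s
  verdict-fixed s e = cong (λ o → execAt o s) e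

  infix 4 _⇝_
  _⇝_ : State → State → Set
  s ⇝ s′ = ∃ λ t → steps t s ≡ s′

  ⇝-trans : ∀ {s s′ s″} → s ⇝ s′ → s′ ⇝ s″ → s ⇝ s″
  ⇝-trans {s} (j , refl) (k , refl) = k + j , steps-+ k j s

  ⇝-step : ∀ s {op} → nth code (pc s) ≡ just op → s ⇝ exec op s
  ⇝-step s e = 1 , cong (λ o → execAt o s) e

  pairLoop-step : ∀ s {op k} → nth code (pc s) ≡ just op → (∀ s → exec op s ≡ pairLoop k s) → s ⇝ pairLoop k s
  pairLoop-step s e unfold = 1 , trans (cong (λ o → execAt o s) e) (unfold s)

  double-run : ∀ {p n v g} → nth code p ≡ just double → ∀ u z →
               ⟪ p , n , u , v , z , g ⟫ ⇝ ⟪ suc p , n , 0 , v , z + u , g ⟫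
  double-run {p} {n} {v} {g} e zero    z rewrite +-identityʳ z = ⇝-step ⟪ p , n , 0 , v , z , g ⟫ e
  double-run {p} {n} {v} {g} e (suc u) z rewrite +-suc z u     =
    ⇝-trans (⇝-step ⟪ p , n , suc u , v , z , g ⟫ e) (double-run e u (suc z))

  -- Recursion on the code `m` of the pair: each step moves to the preceding pair of the enumeration
  -- and so lowers the code by one.
  pairLoop-run : ∀ {p n g op k} → nth code p ≡ just op → (∀ s → exec op s ≡ pairLoop k s) →
                 ∀ u v z m → ⟨ u , v ⟩ ≡ m → ⟪ p , n , u , v , z , g ⟫ ⇝ ⟪ p , n , 0 , 0 , z + m , g ⟫
  pairLoop-run e unfold u (suc v) z zero m = contradiction (trans (sym (⟨,⟩-up u v)) m) ℕₚ.1+n≢0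
  pairLoop-run {p} {n} {g} e unfold u (suc v) z (suc m) h rewrite +-suc z m =
    ⇝-trans (pairLoop-step ⟪ p , n , u , suc v , z , g ⟫ e unfold)
      (pairLoop-run e unfold (suc u) v (suc z) m (suc-injective (trans (sym (⟨,⟩-up u v)) h)))
  pairLoop-run e unfold (suc u) zero z zero m = contradiction (trans (sym (⟨,⟩-wrap u)) m) ℕₚ.1+n≢0
  pairLoop-run {p} {n} {g} e unfold (suc u) zero z (suc m) h rewrite +-suc z m =
    ⇝-trans (pairLoop-step ⟪ p , n , suc u , 0 , z , g ⟫ e unfold)
      (pairLoop-run e unfold 0 u (suc z) m (suc-injective (trans (sym (⟨,⟩-wrap u)) h)))
  pairLoop-run e unfold zero zero z m refl rewrite ⟨,⟩-zero | +-identityʳ z = 0 , refl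

  pairLoop-sum : ∀ {p n g op k} → nth code p ≡ just op → (∀ s → exec op s ≡ pairLoop k s) →
                 ∀ u v z w → z + ⟨ u , v ⟩ ≡ w → ⟪ p , n , u , v , z , g ⟫ ⇝ ⟪ p , n , 0 , 0 , w , g ⟫
  pairLoop-sum e unfold u v z w refl = pairLoop-run e unfold u v z ⟨ u , v ⟩ refl

  pairing : ℕ → ℕ → Load → ℕ
  pairing n z (literal c) = ⟨ c , z ⟩
  pairing n z input       = ⟨ z , n ⟩

  -- Each operation first completes the pairing loaded by its predecessor; `w` is the value once the
  -- pending pairing has been added to `z`.
  loads-run : ∀ loads rest {p n g} → (∀ j → nth code (p + j) ≡ nth (map pairThen loads ++ pairLaunch ∷ rest) j) →
              ∀ u v z w → z + ⟨ u , v ⟩ ≡ w →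
              ⟪ p , n , u , v , z , g ⟫ ⇝
              (let w′ = foldl (pairing n) w loads
               in ⟪ suc (p + length loads) , n , 0 , 0 , w′ , proj₂ (initConfig w′) ⟫)
  loads-run [] rest {p} {n} {g} h u v z w e =
    subst (λ q → ⟪ p , n , u , v , z , g ⟫ ⇝ ⟪ suc q , n , 0 , 0 , w , proj₂ (initConfig w) ⟫)
      (sym (+-identityʳ p))
      (⇝-trans (pairLoop-sum at (λ _ → refl) u v z w e) (⇝-step ⟪ p , n , 0 , 0 , w , g ⟫ at))
    where
    at : nth code p ≡ just pairLaunch
    at = trans (cong (nth code) (sym (+-identityʳ p))) (h 0)
  loads-run (a ∷ as) rest {p} {n} {g} h u v z w e =
    ⇝-trans (pairLoop-sum at (λ _ → refl) u v z w e) (⇝-trans (⇝-step ⟪ p , n , 0 , 0 , w , g ⟫ at) (continue a))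
    where
    at : nth code p ≡ just (pairThen a)
    at = trans (cong (nth code) (sym (+-identityʳ p))) (h 0)
    rest-run : ∀ u v w → ⟨ u , v ⟩ ≡ w → ⟪ suc p , n , u , v , 0 , g ⟫ ⇝
               (let w′ = foldl (pairing n) w as
                in ⟪ suc (p + suc (length as)) , n , 0 , 0 , w′ , proj₂ (initConfig w′) ⟫)
    rest-run u v w e rewrite +-suc p (length as) =
      loads-run as rest (λ j → trans (cong (nth code) (sym (+-suc p j))) (h (suc j))) u v 0 w e
    continue : ∀ a → load a ⟪ p , n , 0 , 0 , w , g ⟫ ⇝
               (let w′ = foldl (pairing n) (pairing n w a) as
                in ⟪ suc (p + suc (length as)) , n , 0 , 0 , w′ , proj₂ (initConfig w′) ⟫)
    continue (literal c) = rest-run c w _ refl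
    continue input       = rest-run w n _ refl

  initial : ℕ → State
  initial q = ⟪ 0 , q , 0 , 0 , 0 , (λ _ → 0) ⟫

  -- Taken at input 0: only `rN`, which has index `zero`, depends on the input. This keeps `Θ`
  -- independent of `q`.
  ini : Fin (4 + (R + K)) → ℕ
  ini s = value (initial 0) (reg (suc s))

  open Simulation (4 + (R + K)) idx reg reg-idx tree ini

  initial-start : ∀ q s → value (initial q) (reg s) ≡ start q s
  initial-start q zero                            = refl
  initial-start q (suc zero)                      = refl
  initial-start q (suc (suc zero))                = refl
  initial-start q (suc (suc (suc zero)))          = refl
  initial-start q (suc (suc (suc (suc zero))))    = refl
  initial-start q (suc (suc (suc (suc (suc s))))) with splitAt R s
  ... | inj₁ _ = refl
  ... | inj₂ _ = refl

  -- The diagonal argument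

  module _ (D : Dom) (fits : All Fits code) (q t : ℕ) where

    private
      V : ℕ → Register → ℕ
      V t = value (steps t (initial q))

    accepted-realizable : Accepts (steps t (initial q)) → Realizable D 3 (winning q)
    accepted-realizable accepts =
      realizable D q V (initial-start q) follows t (accept-stops (steps t (initial q)) accepts)
      where
      follows : ∀ t → reach tree (V t) ≡ nothing ⊎ Follows tree (V t) (V (suc t))
      follows t with progress fits (steps t (initial q))
      ... | inj₁ a = inj₁ (accept-stops (steps t (initial q)) a)
      ... | inj₂ f = inj₂ f

    -- A state at `verdict` is fixed, and a run has only one fixed state. It carries 1 in register
    -- 0, so no accepting state ever occurs and the run is endless.
    rejected-unrealizable : nth code (pc (steps t (initial q))) ≡ just verdict → regs (steps t (initial q)) 0 ≡ 1 →
                            ¬ Realizable D 3 (winning q)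
    rejected-unrealizable atVerdict one = unrealizable D q V (initial-start q) follows
      where
      rejects : ∀ t′ → ¬ Accepts (steps t′ (initial q))
      rejects t′ (e , zero′) = ℕₚ.0≢1+n (trans (sym zero′) (trans (cong (λ s → regs s 0)
        (fixed-unique t′ t (initial q) (verdict-fixed (steps t′ (initial q)) e)
                                       (verdict-fixed (steps t (initial q)) atVerdict))) one))
      follows : ∀ t → Follows tree (V t) (V (suc t))
      follows t with progress fits (steps t (initial q))
      ... | inj₁ a = contradiction a (rejects t)
      ... | inj₂ f = f

  -- If the instance were realizable, the answer 1 would make the machine run forever, contradicting
  -- realizability. Hence it is unrealizable, so the answer is 0, the machine stops and the instance
  -- is realizable after all.
  diagonal : ∀ D P → All Fits code →
             (∀ q {m} → Outputs P (instanceCode (q * 2) q) m →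
               ∃ λ t → nth code (pc (steps t (initial q))) ≡ just verdict × regs (steps t (initial q)) 0 ≡ m) →
             ¬ Decides D P
  diagonal D P fits outcome decides = impossible (accepted-realizable D fits q (proj₁ accepted) (proj₂ accepted))
    where
    q : ℕ
    q = formulaCode Θ
    outputs : ∀ {m} → Outputs P ⟨ 3 , formulaCode (winning q) ⟩ m → Outputs P (instanceCode (q * 2) q) m
    outputs {m} = subst (λ c → Outputs P c m) (code-winning (q * 2) Θ)
    impossible : ¬ Realizable D 3 (winning q)
    impossible r with outcome q (outputs (proj₁ (decides-code {D} {P} decides 3 (winning q)) r))
    ... | t , atVerdict , one = rejected-unrealizable D fits q t atVerdict one r
    accepted : ∃ λ t → Accepts (steps t (initial q))
    accepted = outcome q (outputs (proj₂ (decides-code {D} {P} decides 3 (winning q)) impossible))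

-- The machine built from a supposed decision program

maxReg : Program → ℕ
maxReg []              = 0
maxReg (inc r ∷ P)     = r ⊔ maxReg P
maxReg (decjz r l ∷ P) = r ⊔ maxReg P

-- The operands met when coding the instance outwards from the look-ahead 2q, as in instanceCode.
loads : List Load
loads = literal 0 ∷ literal 1 ∷ literal 0 ∷ literal 1 ∷ literal 0 ∷ literal 0 ∷ literal 1 ∷ input ∷
        literal 2 ∷ literal 1 ∷ literal 1 ∷ literal 3 ∷ []

-- The relocated program is preceded by 15 operations.
relocate : ℕ → Instr → Op
relocate len (inc r)     = incr r
relocate len (decjz r l) = decr r (15 + (l ⊓ len))

module Diagonal (P : Program) where

  len : ℕ
  len = length P

  tail : List Op
  tail = map (relocate len) P ++ verdict ∷ []

  open Machine (maxReg P) copyInput (double ∷ map pairThen loads ++ pairLaunch ∷ tail) public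

  fits : All Fits code
  fits = tt ∷ tt ∷ s≤s z≤n ∷ s≤s (s≤s z≤n) ∷ s≤s z≤n ∷ s≤s (s≤s z≤n) ∷ s≤s z≤n ∷ s≤s z≤n ∷ s≤s (s≤s z≤n) ∷ tt ∷
         s≤s (s≤s (s≤s z≤n)) ∷ s≤s (s≤s z≤n) ∷ s≤s (s≤s z≤n) ∷ s≤s (s≤s (s≤s (s≤s z≤n))) ∷ tt ∷
         All.++⁺ (All.map⁺ (instructions P (λ r≤ → s≤s r≤))) (tt ∷ [])
    where
    target : ∀ l → 15 + (l ⊓ len) < K
    target l = +-monoʳ-< 15 (≤-trans (s≤s (m⊓n≤n l len))
      (subst (suc len ≤_) (sym (length-++ (map (relocate len) P)))
        (subst (_≤ length (map (relocate len) P) + 1) (+-comm len 1)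
          (subst (λ m → len + 1 ≤ m + 1) (sym (length-map (relocate len) P)) ≤-refl))))
    instructions : ∀ Q → (∀ {r} → r ≤ maxReg Q → r < R) → All (Fits ∘ relocate len) Q
    instructions []              h = []
    instructions (inc r ∷ Q)     h = tt ∷ instructions Q λ r≤ → h (≤-trans r≤ (m≤n⊔m r (maxReg Q)))
    instructions (decjz r l ∷ Q) h =
      (h (m≤m⊔n r (maxReg Q)) , target l) ∷ instructions Q λ r≤ → h (≤-trans r≤ (m≤n⊔m r (maxReg Q)))

  module Run (q : ℕ) where

    result : ℕ
    result = foldl (pairing q) (q * 2) loads

    -- All halted program counters are sent to `len`, the offset at which `verdict` stands.
    embed : Config → State
    embed (p , g) = ⟪ 15 + (p ⊓ len) , q , 0 , 0 , result , g ⟫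

    initial-run : initial q ⇝ embed (initConfig result)
    -- `copyInput` puts `q` into both `u` and `z`, so `double` leaves `q + q` in `z`.
    initial-run = ⇝-trans (⇝-step (initial q) refl) (⇝-trans (double-run refl q q)
      (loads-run loads tail (λ _ → refl) 0 0 (q + q) (q * 2) doubled))
      where
      doubled : (q + q) + ⟨ 0 , 0 ⟩ ≡ q * 2
      doubled = trans (cong ((q + q) +_) ⟨,⟩-zero) (trans (+-identityʳ (q + q))
        (trans (cong (q +_) (sym (+-identityʳ q))) (*-comm 2 q)))

    instr-run : ∀ c i → nth P (proj₁ c) ≡ just i → embed c ⇝ embed (execInstr i c)
    instr-run (p , g) i found = subst (embed (p , g) ⇝_) (agrees i) (⇝-step (embed (p , g)) at)
      where
      p<len : p < len
      p<len = nth-< P p found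
      p⊓len : p ⊓ len ≡ p
      p⊓len = m≤n⇒m⊓n≡m (<⇒≤ p<len)
      at : nth code (15 + (p ⊓ len)) ≡ just (relocate len i)
      at = trans (cong (nth tail) p⊓len) (nth-map-++ (relocate len) P (verdict ∷ []) p found)
      following : suc (p ⊓ len) ≡ suc p ⊓ len
      following = trans (cong suc p⊓len) (sym (m≤n⇒m⊓n≡m p<len))
      agrees : ∀ i → exec (relocate len i) (embed (p , g)) ≡ embed (execInstr i (p , g))
      agrees (inc r) = cong (λ m → ⟪ 15 + m , q , 0 , 0 , _ , _ ⟫) following
      agrees (decjz r l) with g r
      ... | zero  = refl
      ... | suc m = cong (λ m → ⟪ 15 + m , q , 0 , 0 , _ , _ ⟫) following

    program-run : ∀ t c → Halted P (run P t c) → embed c ⇝ embed (run P t c)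
    program-run zero    c h = 0 , refl
    program-run (suc t) c h with nth P (proj₁ c) in found
    ... | nothing = program-run t c h
    ... | just i  = ⇝-trans (instr-run c i found) (program-run t (execInstr i c) h)

    halted-verdict : ∀ c → Halted P c → nth code (pc (embed c)) ≡ just verdict
    halted-verdict (p , g) h rewrite m≥n⇒m⊓n≡n (nth-nothing P p h) = nth-length (relocate len) P verdict []

    outcome : ∀ {m} → Outputs P result m →
              ∃ λ t → nth code (pc (steps t (initial q))) ≡ just verdict × regs (steps t (initial q)) 0 ≡ m
    outcome (t , h , e) with ⇝-trans initial-run (program-run t (initConfig result) h)
    ... | k , reached = k , trans (cong (nth code ∘ pc) reached) (halted-verdict (run P t (initConfig result)) h)
                          , trans (cong (λ s → regs s 0) reached) e

theorem1 : (D : Dom) → Undecidable D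
-- `result` unfolds to `instanceCode (q * 2) q`, so `Run.outcome` has the required type.
theorem1 D (P , decides) = diagonal D P fits Run.outcome decides
  where open Diagonal P
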